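{- Any tree-like Resolution refutation of $\mathrm{RIP}_n$ is of size $2^{\Omega(n)}$; that is, there is a constant $c>0$ such that for all sufficiently large $n$, every tree-like Resolution refutation of $\mathrm{RIP}_n$ has size at least $2^{cn}$.
   Context: Notation: $[n]=\{1,\dots,n\}$. A clause is a disjunction of literals (propositional variables or their negations). Resolution: from clauses $\mathcal P\vee x$ and $\mathcal Q\vee\neg x$ derive $\mathcal P\vee\mathcal Q$ (resolution rule); from $\mathcal P$ derive $\mathcal P\vee\ell$ for any literal $\ell$ (weakening). A Resolution refutation of a set of clauses is a derivation of the empty clause from these clauses (axioms), viewed as a directed acyclic graph whose sources are axioms and whose only sink is the empty clause. It is tree-like if the graph is a tree (each derived clause is used at most once as a premise; axioms may be repeated at different leaves). The size is the number of internal nodes, i.e. the number of rule applications. The contradiction $\mathrm{RIP}_n$ (relativized Induction principle, $n\ge 2$). Variables: $P_i$, $R_i$ for $i\in[n]$, and $S_{i,j}$ for $1\le i<j\le n$. The clauses are: $P_1$ and $\neg P_n$; $R_1$ and $R_n$; $\bigvee_{j=i+1}^{n}S_{i,j}$ for $i\in[n-1]$; $\neg S_{i,j}\vee\neg R_i\vee R_j$ for $i,j\in[n]$, $i<j$; $\neg S_{i,j}\vee\neg R_i\vee\neg P_i\vee P_j$ for $i,j\in[n]$, $i<j$. -}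

module Defs where

open import Data.Fin.Base using (Fin; toℕ; _<_)
open import Data.Fin.Properties using (_<?_)
open import Data.Integer.Base using (∣_∣)
open import Data.List.Base using (List; []; _∷_; [_]; _++_; mapMaybe; allFin)
open import Data.List.Relation.Binary.BagAndSetEquality using (_∼[_]_; set)
import Data.Maybe.Base as Maybe
open import Data.Nat.Base as ℕ using (ℕ; suc; _+_; _*_; _^_)
open import Data.Rational.Base using (ℚ; ↥_; ↧ₙ_)
open import Relation.Binary.PropositionalEquality.Core using (_≡_)
open import Relation.Nullary.Decidable.Core using (dec⇒maybe)

data Literal (V : Set) : Set where
  pos neg : V → Literal V

-- A list stands for the set of its members; clauses are compared with the
-- set equality _∼[ set ]_, so order and repetition of literals are
-- irrelevant, and disjunction is _++_.
Clause : Set → Set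
Clause V = List (Literal V)

-- The set equalities in the constructors only identify different list
-- presentations of one clause; they are not rule applications.
data TreeDerivation {V : Set} (Axiom : Clause V → Set) : Clause V → Set where
  axiom   : ∀ {A C} → Axiom A → C ∼[ set ] A → TreeDerivation Axiom C
  resolve : ∀ {C D E} (A B : Clause V) (x : V) →
            TreeDerivation Axiom C → C ∼[ set ] A ++ [ pos x ] →
            TreeDerivation Axiom D → D ∼[ set ] B ++ [ neg x ] →
            E ∼[ set ] A ++ B →
            TreeDerivation Axiom E
  weaken  : ∀ {C D} (ℓ : Literal V) →
            TreeDerivation Axiom C → D ∼[ set ] C ++ [ ℓ ] →
            TreeDerivation Axiom D

TreeRefutation : {V : Set} → (Clause V → Set) → Set
TreeRefutation Axiom = TreeDerivation Axiom []

size : ∀ {V Axiom} {C : Clause V} → TreeDerivation Axiom C → ℕ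
size (axiom _ _)             = 0
size (resolve _ _ _ π _ ρ _ _) = suc (size π + size ρ)
size (weaken _ π _)          = suc (size π)

-- The index set [n] = {1,…,n} is Fin n, with k represented by the i such
-- that suc (toℕ i) ≡ k.
data Var (n : ℕ) : Set where
  P R : Fin n → Var n
  S   : (i j : Fin n) → .(i < j) → Var n

-- ⋁_{j > i} S_{i,j}
someSuccessor : ∀ {n} → Fin n → Clause (Var n)
someSuccessor {n} i =
  mapMaybe (λ j → Maybe.map (λ i<j → pos (S i j i<j)) (dec⇒maybe (i <? j)))
           (allFin n)

data RIP (n : ℕ) : Clause (Var n) → Set where
  P-first : ∀ {i} → suc (toℕ i) ≡ 1 → RIP n [ pos (P i) ]
  P-last  : ∀ {i} → suc (toℕ i) ≡ n → RIP n [ neg (P i) ]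
  R-first : ∀ {i} → suc (toℕ i) ≡ 1 → RIP n [ pos (R i) ]
  R-last  : ∀ {i} → suc (toℕ i) ≡ n → RIP n [ pos (R i) ]
  S-some  : ∀ {i} → suc (toℕ i) ℕ.< n → RIP n (someSuccessor i)
  R-step  : ∀ {i j} (i<j : i < j) →
            RIP n (neg (S i j i<j) ∷ neg (R i) ∷ pos (R j) ∷ [])
  P-step  : ∀ {i j} (i<j : i < j) →
            RIP n (neg (S i j i<j) ∷ neg (R i) ∷ neg (P i) ∷ pos (P j) ∷ [])

-- s ≥ 2^(c n) for a nonnegative rational c = a / b, cleared of roots as
-- 2^(a n) ≤ s^b.
infix 4 _≥2^_·_
_≥2^_·_ : ℕ → ℚ → ℕ → Set
s ≥2^ c · n = 2 ^ (∣ ↥ c ∣ * n) ℕ.≤ s ^ ↧ₙ c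

{-# OPTIONS --safe #-}

-- A Prover–Delayer game: walking from the empty clause to an axiom, Prover
-- queries the resolved variables and Delayer answers, so that the current
-- clause is always falsified. If a potential is nowhere more than a constant
-- plus the sum of its values after the two answers (or does not drop when only
-- one answer is offered) and vanishes at axioms, it bounds the size of the tree.
--
-- Delayer maintains a chain of vertices, starting at 1, that satisfy R and P
-- and each of which points to the next. An untouched vertex that is queried
-- directly is retired: it falsifies R, or satisfies R, falsifies P and points
-- to n. Asking whether the end of the chain points to j either moves the end
-- to j or excludes j as a successor. Only an end without possible successors
-- falsifies an axiom; the potential of a state estimates the number of
-- increasing chains that extend the current one, with base 4/3 instead of 2 to
-- leave room for the retired vertices.
module Submission where

open import Defs
open import Data.Nat.Base using (ℕ; _≤_)
open import Data.Product.Base using (_×_; ∃-syntax)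
open import Data.Rational.Base using (ℚ; Positive)

open import Data.Bool.Base using (Bool; true; false; not)
open import Data.Fin.Base as Fin using (Fin; zero; suc; toℕ; fromℕ)
open import Data.Fin.Properties as Fin using (toℕ-injective; toℕ-fromℕ)
import Data.Integer.Base as ℤ
open import Data.List.Base using (allFin)
open import Data.List.Membership.Propositional using (_∈_; lose)
open import Data.List.Membership.Propositional.Properties
  using (∈-++⁻; ∈-++⁺ˡ; ∈-++⁺ʳ; ∈-allFin; ∈-map⁺)
open import Data.List.Relation.Unary.Any using (here; there)
open import Data.List.Relation.Unary.Any.Properties using (mapMaybe⁺)
open import Data.Maybe.Base as Maybe using (Maybe; just; nothing)
open import Data.Maybe.Properties using (just-injective)
open import Data.Maybe.Relation.Unary.Any using (Any; just)
open import Data.Nat.Base using (zero; suc; _+_; _*_; _∸_; _^_; _<_; z≤n; s≤s)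
open import Data.Nat.DivMod as ℕ using (m/n*n≤m; m≡m%n+[m/n]*n; m%n<n)
open import Data.Nat.Properties
open import Data.Nat.Tactic.RingSolver using (solve-∀)
open import Data.Product.Base using (_,_; proj₁; proj₂)
open import Data.Rational.Base using (_/_)
open import Data.Sum.Base using (inj₁; inj₂)
open import Function.Base using (_∘_; case_of_)
open import Function.Bundles using (Equivalence)
open import Relation.Binary.Definitions using (tri<; tri≈; tri>)
open import Relation.Binary.PropositionalEquality
open import Relation.Nullary using (yes; no; contradiction)
open import Relation.Nullary.Decidable.Core using (⌊_⌋; dec⇒maybe)

-- Partial assignments and the Prover-Delayer bound.

Assignment : Set → Set
Assignment V = V → Maybe Bool

Falsified : ∀ {V} → Assignment V → Literal V → Set
Falsified α (pos x) = α x ≡ just false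
Falsified α (neg x) = α x ≡ just true

Falsifies : ∀ {V} → Assignment V → Clause V → Set
Falsifies α C = ∀ {ℓ} → ℓ ∈ C → Falsified α ℓ

infix 4 _⊑_
_⊑_ : ∀ {V} → Assignment V → Assignment V → Set
α ⊑ β = ∀ x {b} → α x ≡ just b → β x ≡ just b

falsified-mono : ∀ {V} {α β : Assignment V} → α ⊑ β → ∀ ℓ → Falsified α ℓ → Falsified β ℓ
falsified-mono α⊑β (pos x) = α⊑β x
falsified-mono α⊑β (neg x) = α⊑β x

module ProverDelayer {V State : Set} (assign : State → Assignment V) (value : State → ℕ) (K : ℕ) where

  data Response (σ : State) (x : V) : Set where
    forced : ∀ b τ → assign σ ⊑ assign τ → assign τ x ≡ just b → value σ ≤ value τ →
             Response σ x
    branch : (τ : Bool → State) → (∀ b → assign σ ⊑ assign (τ b)) →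
             (∀ b → assign (τ b) x ≡ just b) →
             value σ ≤ K + (value (τ true) + value (τ false)) →
             Response σ x

  -- Delayer may first extend the assignment unasked, provided the potential does not drop, and
  -- answer from there; this is how the chain moves on before a query is answered.
  after : ∀ {σ τ x} → assign σ ⊑ assign τ → value σ ≤ value τ → Response τ x → Response σ x
  after σ⊑τ σ≤τ (forced b υ τ⊑υ eq τ≤υ) =
    forced b υ (λ y → τ⊑υ y ∘ σ⊑τ y) eq (≤-trans σ≤τ τ≤υ)
  after σ⊑τ σ≤τ (branch υ τ⊑υ eq τ≤υ) =
    branch υ (λ b y → τ⊑υ b y ∘ σ⊑τ y) eq (≤-trans σ≤τ τ≤υ)

  module _ {Axiom : Clause V → Set}
           (respond : ∀ σ x → Response σ x)
           (lost : ∀ {A} σ → Axiom A → Falsifies (assign σ) A → value σ ≡ 0) where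

    -- Induction on the tree. A resolution step pays the `K` of a branch; a forced answer follows
    -- one premise only, and weakening keeps the state, its premise being part of the falsified
    -- clause.
    value≤size : ∀ {C} (π : TreeDerivation Axiom C) σ → Falsifies (assign σ) C →
                 value σ ≤ K * size π
    value≤size (axiom ax C∼A) σ fals =
      ≤-trans (≤-reflexive (lost σ ax (λ ℓ∈A → fals (Equivalence.from C∼A ℓ∈A)))) z≤n
    value≤size (weaken ℓ π D∼C) σ fals =
      ≤-trans (value≤size π σ (λ ℓ∈C → fals (Equivalence.from D∼C (∈-++⁺ˡ ℓ∈C))))
              (*-monoʳ-≤ K (n≤1+n (size π)))
    value≤size {E} (resolve {C} {D} A B x π C∼A ρ D∼B E∼AB) σ fals = by (respond σ x)
      where
      left : ∀ τ → assign σ ⊑ assign τ → assign τ x ≡ just false → value τ ≤ K * size π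
      left τ σ⊑τ eq = value≤size π τ λ {ℓ} ℓ∈C → case ∈-++⁻ A (Equivalence.to C∼A ℓ∈C) of λ where
        (inj₁ ℓ∈A) → falsified-mono σ⊑τ ℓ (fals (Equivalence.from E∼AB (∈-++⁺ˡ ℓ∈A)))
        (inj₂ (here refl)) → eq

      right : ∀ τ → assign σ ⊑ assign τ → assign τ x ≡ just true → value τ ≤ K * size ρ
      right τ σ⊑τ eq = value≤size ρ τ λ {ℓ} ℓ∈D → case ∈-++⁻ B (Equivalence.to D∼B ℓ∈D) of λ where
        (inj₁ ℓ∈B) → falsified-mono σ⊑τ ℓ (fals (Equivalence.from E∼AB (∈-++⁺ʳ A ℓ∈B)))
        (inj₂ (here refl)) → eq

      by : Response σ x → value σ ≤ K * suc (size π + size ρ)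
      by (forced false τ σ⊑τ eq σ≤τ) = ≤-trans σ≤τ (≤-trans (left τ σ⊑τ eq)
        (*-monoʳ-≤ K (m≤n⇒m≤1+n (m≤m+n (size π) (size ρ)))))
      by (forced true τ σ⊑τ eq σ≤τ) = ≤-trans σ≤τ (≤-trans (right τ σ⊑τ eq)
        (*-monoʳ-≤ K (m≤n⇒m≤1+n (m≤n+m (size ρ) (size π)))))
      by (branch τ σ⊑τ eq σ≤τ) = begin
        value σ                                         ≤⟨ σ≤τ ⟩
        K + (value (τ true) + value (τ false))          ≤⟨ +-monoʳ-≤ K (+-mono-≤ (right _ (σ⊑τ true) (eq true)) (left _ (σ⊑τ false) (eq false))) ⟩
        K + (K * size ρ + K * size π)                   ≡⟨ cong (_+_ K) (trans (sym (*-distribˡ-+ K (size ρ) (size π))) (cong (K *_) (+-comm (size ρ) (size π)))) ⟩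
        K + K * (size π + size ρ)                       ≡⟨ *-suc K (size π + size ρ) ⟨
        K * suc (size π + size ρ)                       ∎
        where open ≤-Reasoning

-- Integer weights of growth rate at most 4/3.

-- Any growth rate at most 4/3 suits the potential; this sequence keeps to it
-- within ℕ, interpolating 3 · 2^q linearly between the multiples of 3.
weight : ℕ → ℕ
weight 0 = 3
weight 1 = 4
weight 2 = 5
weight (suc (suc (suc k))) = 2 * weight k

-- The ratios 4/3, 5/4, 6/5 recur, since three steps double the weight.
3weight-suc≤4weight : ∀ k → 3 * weight (suc k) ≤ 4 * weight k
3weight-suc≤4weight 0 = ≤ᵇ⇒≤ 12 12 _
3weight-suc≤4weight 1 = ≤ᵇ⇒≤ 15 16 _
3weight-suc≤4weight 2 = ≤ᵇ⇒≤ 18 20 _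
3weight-suc≤4weight (suc (suc (suc k))) = begin
  3 * (2 * weight (suc k)) ≡⟨ swap 3 (weight (suc k)) ⟩
  2 * (3 * weight (suc k)) ≤⟨ *-monoʳ-≤ 2 (3weight-suc≤4weight k) ⟩
  2 * (4 * weight k)       ≡⟨ swap 4 (weight k) ⟨
  4 * (2 * weight k)       ∎
  where
  open ≤-Reasoning
  swap : ∀ a x → a * (2 * x) ≡ 2 * (a * x)
  swap = solve-∀

weight-3* : ∀ q → weight (q * 3) ≡ 3 * 2 ^ q
weight-3* zero = refl
weight-3* (suc q) = trans (cong (2 *_) (weight-3* q)) (swap (2 ^ q))
  where
  swap : ∀ x → 2 * (3 * x) ≡ 3 * (2 * x)
  swap = solve-∀

weightSum : ℕ → ℕ
weightSum zero = 0
weightSum (suc k) = weight k + weightSum k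

-- Telescoping: each increment of `weight` is at most a third of the current value, so three times
-- all increments stay within `weightSum`; the 9 is `3 * weight 0`.
3weight≤9+weightSum : ∀ k → 3 * weight k ≤ 9 + weightSum k
3weight≤9+weightSum zero = ≤-refl
3weight≤9+weightSum (suc k) = begin
  3 * weight (suc k)            ≤⟨ 3weight-suc≤4weight k ⟩
  4 * weight k                  ≡⟨⟩
  weight k + 3 * weight k       ≤⟨ +-monoʳ-≤ (weight k) (3weight≤9+weightSum k) ⟩
  weight k + (9 + weightSum k)  ≡⟨ swap (weight k) (weightSum k) ⟩
  9 + (weight k + weightSum k)  ∎
  where
  open ≤-Reasoning
  swap : ∀ x y → x + (9 + y) ≡ 9 + (x + y)
  swap = solve-∀

weightSum-mono : ∀ {j k} → j ≤ k → weightSum j ≤ weightSum k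
weightSum-mono {zero} _ = z≤n
weightSum-mono {suc j} {suc k} (s≤s j≤k) with m≤n⇒m<n∨m≡n j≤k
... | inj₂ refl = ≤-refl
... | inj₁ j<k  = ≤-trans (weightSum-mono j<k) (m≤n+m _ (weight k))

-- Marks, and how the potential reacts to changing them.

-- A vertex that is not gone is free: nothing has been decided about it.
-- It is excluded if the current end of the chain must not point to it.
data Mark : Set where
  eligible excluded gone : Mark

free : Mark → ℕ
free gone     = 0
free eligible = 1
free excluded = 1

gain : Mark → ℕ → ℕ
gain eligible k = weight k
gain excluded _ = 0
gain gone     _ = 0

count : ∀ {k} → (Fin k → Mark) → ℕ
count {zero}  f = 0
count {suc k} f = free (f zero) + count (f ∘ suc)

countAbove : ∀ {k} → (Fin k → Mark) → Fin k → ℕ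
countAbove f zero    = count (f ∘ suc)
countAbove f (suc i) = countAbove (f ∘ suc) i

-- The weight at an eligible vertex stands for the chains that continue from it. Excluded vertices
-- above it count as well, because they become possible successors again once the end moves.
potential : ∀ {k} → (Fin k → Mark) → ℕ
potential {zero}  f = 0
potential {suc k} f = gain (f zero) (count (f ∘ suc)) + potential (f ∘ suc)

count-cong : ∀ {k} {f g : Fin k → Mark} → (∀ i → g i ≡ f i) → count g ≡ count f
count-cong {zero}  _  = refl
count-cong {suc k} eq = cong₂ _+_ (cong free (eq zero)) (count-cong (eq ∘ suc))

potential-cong : ∀ {k} {f g : Fin k → Mark} → (∀ i → g i ≡ f i) → potential g ≡ potential f
potential-cong {zero}  _  = refl
potential-cong {suc k} eq =
  cong₂ _+_ (cong₂ gain (eq zero) (count-cong (eq ∘ suc))) (potential-cong (eq ∘ suc))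

free≡1 : ∀ {x} → x ≢ gone → free x ≡ 1
free≡1 {eligible} _ = refl
free≡1 {excluded} _ = refl
free≡1 {gone} x≢gone = contradiction refl x≢gone

count-≥ : ∀ {k} (f : Fin k → Mark) t → t ≤ k → (∀ i → toℕ i < t → f i ≢ gone) → t ≤ count f
count-≥ f zero _ _ = z≤n
count-≥ {suc k} f (suc t) (s≤s t≤k) free-f =
  +-mono-≤ (≤-reflexive (sym (free≡1 (free-f zero (s≤s z≤n)))))
           (count-≥ (f ∘ suc) t t≤k (λ i i<t → free-f (suc i) (s≤s i<t)))

potential-none : ∀ {k} (f : Fin k → Mark) → (∀ i → f i ≢ eligible) → potential f ≡ 0
potential-none {zero} f _ = refl
potential-none {suc k} f none with f zero in eq
... | eligible = contradiction eq (none zero)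
... | excluded = potential-none (f ∘ suc) (none ∘ suc)
... | gone     = potential-none (f ∘ suc) (none ∘ suc)

-- Without exclusions all free vertices are eligible and see, from the top down, 0, 1, 2, ... free
-- vertices above them.
potential-all : ∀ {k} (f : Fin k → Mark) → (∀ i → f i ≢ excluded) → potential f ≡ weightSum (count f)
potential-all {zero} f _ = refl
potential-all {suc k} f all with f zero in eq
... | eligible = cong (weight (count (f ∘ suc)) +_) (potential-all (f ∘ suc) (all ∘ suc))
... | excluded = contradiction eq (all zero)
... | gone     = potential-all (f ∘ suc) (all ∘ suc)

module _ where
  private
    tail≢ : ∀ {k} {f g : Fin (suc k) → Mark} {i} → (∀ j → j ≢ suc i → g j ≡ f j) →
            ∀ j → j ≢ i → g (suc j) ≡ f (suc j)
    tail≢ same j j≢i = same (suc j) (j≢i ∘ Fin.suc-injective)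

  count-exclude : ∀ {k} (f g : Fin k → Mark) i → f i ≢ gone → g i ≢ gone →
                  (∀ j → j ≢ i → g j ≡ f j) → count g ≡ count f
  count-exclude f g zero fi gi same =
    cong₂ _+_ (trans (free≡1 gi) (sym (free≡1 fi))) (count-cong (λ j → same (suc j) λ ()))
  count-exclude f g (suc i) fi gi same =
    cong₂ _+_ (cong free (same zero λ ())) (count-exclude (f ∘ suc) (g ∘ suc) i fi gi (tail≢ same))

  -- An excluded vertex stays free, so the counts seen from below do not change and only its own
  -- weight is lost.
  potential-exclude : ∀ {k} (f g : Fin k → Mark) i → f i ≡ eligible → g i ≡ excluded →
                      (∀ j → j ≢ i → g j ≡ f j) →
                      potential f ≡ weight (countAbove f i) + potential g
  potential-exclude f g zero fi gi same rewrite fi | gi =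
    cong (weight (count (f ∘ suc)) +_) (sym (potential-cong (λ j → same (suc j) λ ())))
  potential-exclude f g (suc i) fi gi same = begin
    a + potential (f ∘ suc)          ≡⟨ cong (a +_) (potential-exclude (f ∘ suc) (g ∘ suc) i fi gi (tail≢ same)) ⟩
    a + (b + potential (g ∘ suc))    ≡⟨ swap a b _ ⟩
    b + (a + potential (g ∘ suc))    ≡⟨ cong (λ x → b + (x + potential (g ∘ suc))) a≡a′ ⟩
    b + potential g                  ∎
    where
    open ≡-Reasoning
    a b : ℕ
    a = gain (f zero) (count (f ∘ suc))
    b = weight (countAbove (f ∘ suc) i)
    swap : ∀ a b c → a + (b + c) ≡ b + (a + c)
    swap = solve-∀
    a≡a′ : a ≡ gain (g zero) (count (g ∘ suc))
    a≡a′ = cong₂ gain (sym (same zero λ ())) (sym (count-exclude (f ∘ suc) (g ∘ suc) i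
      (λ eq → case trans (sym fi) eq of λ ()) (λ eq → case trans (sym gi) eq of λ ()) (tail≢ same)))

  count-retire : ∀ {k} (f g : Fin k → Mark) i → f i ≢ gone → g i ≡ gone →
                 (∀ j → j ≢ i → g j ≡ f j) → count f ≡ suc (count g)
  count-retire f g zero fi gi same rewrite free≡1 fi | gi =
    cong suc (sym (count-cong (λ j → same (suc j) λ ())))
  count-retire f g (suc i) fi gi same
    rewrite same zero (λ ()) | count-retire (f ∘ suc) (g ∘ suc) i fi gi (tail≢ same) =
    +-suc (free (f zero)) _

  3gain-suc≤4gain : ∀ x k → 3 * gain x (suc k) ≤ 4 * gain x k
  3gain-suc≤4gain eligible k = 3weight-suc≤4weight k
  3gain-suc≤4gain excluded k = z≤n
  3gain-suc≤4gain gone     k = z≤n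

  -- Besides the gain of `i` itself, each eligible vertex below `i` sees one free vertex fewer,
  -- which leaves at least 3/4 of its weight; those above `i` lose nothing.
  potential-retire : ∀ {k} (f g : Fin k → Mark) i → f i ≢ gone → g i ≡ gone →
                     (∀ j → j ≢ i → g j ≡ f j) →
                     3 * potential f ≤ 3 * gain (f i) (countAbove f i) + 4 * potential g
  potential-retire f g zero fi gi same rewrite gi = begin
    3 * (b + potential (f ∘ suc))      ≡⟨ *-distribˡ-+ 3 b _ ⟩
    3 * b + 3 * potential (f ∘ suc)    ≤⟨ +-monoʳ-≤ (3 * b) (*-monoˡ-≤ (potential (f ∘ suc)) (n≤1+n 3)) ⟩
    3 * b + 4 * potential (f ∘ suc)    ≡⟨ cong (λ x → 3 * b + 4 * x) (potential-cong (λ j → same (suc j) λ ())) ⟨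
    3 * b + 4 * potential (g ∘ suc)    ∎
    where
    open ≤-Reasoning
    b : ℕ
    b = gain (f zero) (count (f ∘ suc))
  potential-retire f g (suc i) fi gi same = begin
    3 * (a + potential (f ∘ suc))                ≡⟨ *-distribˡ-+ 3 a _ ⟩
    3 * a + 3 * potential (f ∘ suc)              ≤⟨ +-mono-≤ 3a≤4a′ (potential-retire (f ∘ suc) (g ∘ suc) i fi gi (tail≢ same)) ⟩
    4 * a′ + (3 * b + 4 * potential (g ∘ suc))   ≡⟨ swap a′ b _ ⟩
    3 * b + 4 * (a′ + potential (g ∘ suc))       ∎
    where
    open ≤-Reasoning
    a a′ b : ℕ
    a  = gain (f zero) (count (f ∘ suc))
    a′ = gain (g zero) (count (g ∘ suc))
    b  = gain (f (suc i)) (countAbove (f ∘ suc) i)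
    swap : ∀ a b c → 4 * a + (3 * b + 4 * c) ≡ 3 * b + 4 * (a + c)
    swap = solve-∀
    3a≤4a′ : 3 * a ≤ 4 * a′
    3a≤4a′ rewrite same zero (λ ()) | count-retire (f ∘ suc) (g ∘ suc) i fi gi (tail≢ same) =
      3gain-suc≤4gain (f zero) _

-- Exclusions concern the current end only, so they lapse when the end moves.
reopen : Mark → Mark
reopen eligible = eligible
reopen excluded = eligible
reopen gone     = gone

reopen≢excluded : ∀ x → reopen x ≢ excluded
reopen≢excluded eligible ()
reopen≢excluded excluded ()
reopen≢excluded gone     ()

free-reopen : ∀ x → free (reopen x) ≡ free x
free-reopen eligible = refl
free-reopen excluded = refl
free-reopen gone     = refl

count-reopen : ∀ {k} (f : Fin k → Mark) → count (reopen ∘ f) ≡ count f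
count-reopen {zero}  f = refl
count-reopen {suc k} f = cong₂ _+_ (free-reopen (f zero)) (count-reopen (f ∘ suc))

-- No exclusion survives above `j`, so `potential-all` applies there. The result is independent of
-- the former exclusions: this is the refill that `respondFree` exploits.
potential-jump : ∀ {k} (f g : Fin k → Mark) j →
                 (∀ i → i Fin.≤ j → g i ≡ gone) → (∀ i → j Fin.< i → g i ≡ reopen (f i)) →
                 potential g ≡ weightSum (countAbove f j)
potential-jump f g zero below above rewrite below zero z≤n =
  trans (potential-cong (λ i → above (suc i) (s≤s z≤n)))
  (trans (potential-all (reopen ∘ f ∘ suc) (λ i → reopen≢excluded (f (suc i))))
         (cong weightSum (count-reopen (f ∘ suc))))
potential-jump f g (suc j) below above rewrite below zero z≤n =
  potential-jump (f ∘ suc) (g ∘ suc) j (λ i i≤j → below (suc i) (s≤s i≤j)) (λ i j<i → above (suc i) (s≤s j<i))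

≟-refl : ∀ {n} (i : Fin n) → ⌊ i Fin.≟ i ⌋ ≡ true
≟-refl i with i Fin.≟ i
... | yes _  = refl
... | no i≢i = contradiction refl i≢i

≟-true⇒≡ : ∀ {n} {i j : Fin n} → ⌊ i Fin.≟ j ⌋ ≡ true → i ≡ j
≟-true⇒≡ {i = i} {j} eq with i Fin.≟ j
... | yes i≡j = i≡j

-- States of the game and the assignments they induce.

module Game (l : ℕ) where

  private
    m n : ℕ
    m = suc l
    n = suc m

  first last : Fin n
  first = zero
  last  = fromℕ m

  -- A passed vertex is an earlier vertex of the chain, pointing to the next
  -- one; its end is active. A low vertex satisfies R but not P, and points to
  -- the last vertex; a dead vertex falsifies R.
  data Status (i : Fin n) : Set where
    -- The bound guarantees two successors, so that one edge out of a free vertex can be refuted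
    -- while another stays true.
    eligible excluded : 2 + toℕ i ≤ m → Status i
    active low : Status i
    passed : (k : Fin n) → i Fin.< k → Status i
    dead   : Bool → (s : Fin n → Bool) → ∃[ k ] (i Fin.< k × s k ≡ true) → Status i

  mark : ∀ {i} → Status i → Mark
  mark (eligible _) = eligible
  mark (excluded _) = excluded
  mark active       = gone
  mark low          = gone
  mark (passed _ _) = gone
  mark (dead _ _ _) = gone

  valueR valueP : ∀ {i} → Status i → Maybe Bool
  valueR (eligible _) = nothing
  valueR (excluded _) = nothing
  valueR active       = just true
  valueR low          = just true
  valueR (passed _ _) = just true
  valueR (dead _ _ _) = just false

  valueP (eligible _) = nothing
  valueP (excluded _) = nothing
  valueP active       = just true
  valueP low          = just false
  valueP (passed _ _) = just true
  valueP (dead p _ _) = just p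

  -- The edges out of the end are read off from the mark of the target, so excluding or retiring a
  -- vertex also decides the edge to it. A gone target counts as refuted, which keeps the chain from
  -- entering a vertex that violates R or P.
  valueS : ∀ {i} → Status i → Mark → Fin n → Maybe Bool
  valueS (eligible _) _ _ = nothing
  valueS (excluded _) _ _ = nothing
  valueS active eligible _ = nothing
  valueS active excluded _ = just false
  valueS active gone     _ = just false
  valueS low          _ j = just ⌊ j Fin.≟ last ⌋
  valueS (passed k _) _ j = just ⌊ j Fin.≟ k ⌋
  valueS (dead _ s _) _ j = just (s j)

  Board : Set
  Board = ∀ i → Status i

  boardAssign : Board → Assignment (Var n)
  boardAssign st (R i)     = valueR (st i)
  boardAssign st (P i)     = valueP (st i)
  boardAssign st (S i j _) = valueS (st i) (mark (st j)) j

  OnChain : ∀ {i} → Status i → Set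
  OnChain s = valueR s ≡ just true × valueP s ≡ just true

  -- `active-below` makes every free vertex a legal target of the end; `passed-to` and `last-low`
  -- give the targets of true edges the values that `edge-end` needs.
  record State : Set where
    field
      status       : Board
      active-below : ∀ {i k} → status i ≡ active → mark (status k) ≢ gone → i Fin.< k
      passed-to    : ∀ {i k i<k} → status i ≡ passed k i<k → OnChain (status k)
      first-chain  : OnChain (status first)
      last-low     : valueR (status last) ≡ just true × valueP (status last) ≡ just false

  open State

  marks : State → Fin n → Mark
  marks σ = mark ∘ status σ

  assign : State → Assignment (Var n)
  assign = boardAssign ∘ status

  value : State → ℕ
  value = potential ∘ marks

  headroom : ∀ {i} (s : Status i) → mark s ≢ gone → 2 + toℕ i ≤ m
  headroom (eligible h) _ = h
  headroom (excluded h) _ = h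
  headroom active       f = contradiction refl f
  headroom low          f = contradiction refl f
  headroom (passed _ _) f = contradiction refl f
  headroom (dead _ _ _) f = contradiction refl f

  -- Together with the two analogues below: no variable owned by a free vertex is decided, so a new
  -- status for it revokes no answer.
  undecidedR : ∀ {i} (s : Status i) → mark s ≢ gone → ∀ {b} → valueR s ≢ just b
  undecidedR (eligible _) _ ()
  undecidedR (excluded _) _ ()
  undecidedR active       f _ = f refl
  undecidedR low          f _ = f refl
  undecidedR (passed _ _) f _ = f refl
  undecidedR (dead _ _ _) f _ = f refl

  undecidedP : ∀ {i} (s : Status i) → mark s ≢ gone → ∀ {b} → valueP s ≢ just b
  undecidedP (eligible _) _ ()
  undecidedP (excluded _) _ ()
  undecidedP active       f _ = f refl
  undecidedP low          f _ = f refl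
  undecidedP (passed _ _) f _ = f refl
  undecidedP (dead _ _ _) f _ = f refl

  undecidedS : ∀ {i} (s : Status i) → mark s ≢ gone → ∀ {x j b} → valueS s x j ≢ just b
  undecidedS (eligible _) _ ()
  undecidedS (excluded _) _ ()
  undecidedS active       f _ = f refl
  undecidedS low          f _ = f refl
  undecidedS (passed _ _) f _ = f refl
  undecidedS (dead _ _ _) f _ = f refl

  -- Excluding or retiring a single free vertex.

  infixl 6 _[_≔_]
  _[_≔_] : Board → (i : Fin n) → Status i → Board
  (st [ i ≔ s ]) j with j Fin.≟ i
  ... | yes refl = s
  ... | no  _    = st j

  update-same : ∀ st i s → (st [ i ≔ s ]) i ≡ s
  update-same st i s with i Fin.≟ i
  ... | yes refl = refl
  ... | no i≢i   = contradiction refl i≢i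

  update-other : ∀ st i s j → j ≢ i → (st [ i ≔ s ]) j ≡ st j
  update-other st i s j j≢i with j Fin.≟ i
  ... | yes j≡i = contradiction j≡i j≢i
  ... | no  _   = refl

  -- None of these statuses is on the chain or eligible, so the invariants of the chain carry over
  -- and no refuted edge into the vertex becomes open.
  data Demoted {i : Fin n} : Status i → Set where
    excluded : ∀ {h} → Demoted (excluded h)
    low      : Demoted low
    dead     : ∀ {p s some} → Demoted (dead p s some)

  -- An edge out of the end is undecided only while its target is eligible, so a decided edge
  -- survives unless the target becomes eligible.
  valueS-mark : ∀ {i} (s : Status i) x y {j b} → (s ≡ active → y ≡ eligible → x ≡ eligible) →
                valueS s x j ≡ just b → valueS s y j ≡ just b
  valueS-mark active eligible y h ()
  valueS-mark active excluded eligible h eq = case h refl refl of λ ()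
  valueS-mark active excluded excluded h eq = eq
  valueS-mark active excluded gone     h eq = eq
  valueS-mark active gone eligible     h eq = case h refl refl of λ ()
  valueS-mark active gone excluded     h eq = eq
  valueS-mark active gone gone         h eq = eq
  valueS-mark low          x y h eq = eq
  valueS-mark (passed _ _) x y h eq = eq
  valueS-mark (dead _ _ _) x y h eq = eq

  module _ (σ : State) (i : Fin n) (free-i : mark (status σ i) ≢ gone)
           (s : Status i) (demoted : Demoted s) where

    private
      st′ : Board
      st′ = status σ [ i ≔ s ]

      ineligible : ∀ {s : Status i} → Demoted s → mark s ≢ eligible
      ineligible excluded ()
      ineligible low      ()
      ineligible dead     ()

      inactive : ∀ {s : Status i} → Demoted s → s ≢ active
      inactive excluded ()
      inactive low      ()
      inactive dead     ()

      unpassed : ∀ {s : Status i} {k i<k} → Demoted s → s ≢ passed k i<k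
      unpassed excluded ()
      unpassed low      ()
      unpassed dead     ()

      mono : boardAssign (status σ) ⊑ boardAssign st′
      mono (R k) eq with k Fin.≟ i
      ... | no _ = eq
      ... | yes refl = contradiction eq (undecidedR (status σ k) free-i)
      mono (P k) eq with k Fin.≟ i
      ... | no _ = eq
      ... | yes refl = contradiction eq (undecidedP (status σ k) free-i)
      mono (S k j _) eq with k Fin.≟ i
      ... | no _ = valueS-mark (status σ k) (mark (status σ j)) (mark (st′ j)) (λ _ → still) eq
        where
        still : mark (st′ j) ≡ eligible → mark (status σ j) ≡ eligible
        still with j Fin.≟ i
        ... | yes refl = λ e → contradiction e (ineligible demoted)
        ... | no _     = λ e → e
      ... | yes refl = contradiction eq (undecidedS (status σ k) free-i)

      active-before : ∀ k → st′ k ≡ active → status σ k ≡ active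
      active-before k eq with k Fin.≟ i
      ... | no _     = eq
      ... | yes refl = contradiction eq (inactive demoted)

      passed-before : ∀ k {j k<j} → st′ k ≡ passed j k<j → status σ k ≡ passed j k<j
      passed-before k eq with k Fin.≟ i
      ... | no _     = eq
      ... | yes refl = contradiction eq (unpassed demoted)

      free-before : ∀ k → mark (st′ k) ≢ gone → mark (status σ k) ≢ gone
      free-before k f with k Fin.≟ i
      ... | yes refl = free-i
      ... | no _     = f

      chain-mono : ∀ {k} → OnChain (status σ k) → OnChain (st′ k)
      chain-mono {k} (r , p) = mono (R k) r , mono (P k) p

    demote : State
    demote .status = st′
    demote .active-below {a} {k} act f = active-below σ (active-before a act) (free-before k f)
    demote .passed-to {a} pass = chain-mono (passed-to σ (passed-before a pass))
    demote .first-chain = chain-mono (first-chain σ)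
    demote .last-low = mono (R last) (proj₁ (last-low σ)) , mono (P last) (proj₂ (last-low σ))

    demote-mono : assign σ ⊑ assign demote
    demote-mono = mono

    demote-other : ∀ j → j ≢ i → marks demote j ≡ marks σ j
    demote-other j j≢i = cong mark (update-other (status σ) i s j j≢i)

    demote-same : marks demote i ≡ mark s
    demote-same = cong mark (update-same (status σ) i s)

  -- Moving the end of the chain.

  i<last : ∀ {i : Fin n} → toℕ i < m → i Fin.< last
  i<last {i} i<m = subst (toℕ i <_) (sym (toℕ-fromℕ m)) i<m

  always : ∀ {i : Fin n} → Bool → toℕ i < m → Status i
  always p i<m = dead p (λ _ → true) (last , i<last i<m , refl)

  -- Free vertices skipped by the chain are settled by falsifying R, which satisfies both step
  -- clauses out of them; the former end records its edge to `j`.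
  leave : ∀ {i j} → i Fin.< j → Status i → Status i
  leave i<j (eligible h) = always false (<-trans (n<1+n _) h)
  leave i<j (excluded h) = always false (<-trans (n<1+n _) h)
  leave i<j active       = passed _ i<j
  leave i<j low          = low
  leave i<j (passed k p) = passed k p
  leave i<j (dead p s x) = dead p s x

  reopenStatus : ∀ {i} → Status i → Status i
  reopenStatus (eligible h) = eligible h
  reopenStatus (excluded h) = eligible h
  reopenStatus active       = active
  reopenStatus low          = low
  reopenStatus (passed k p) = passed k p
  reopenStatus (dead p s x) = dead p s x

  mark-leave : ∀ {i j} (i<j : i Fin.< j) s → mark (leave i<j s) ≡ gone
  mark-leave _ (eligible _) = refl
  mark-leave _ (excluded _) = refl
  mark-leave _ active       = refl
  mark-leave _ low          = refl
  mark-leave _ (passed _ _) = refl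
  mark-leave _ (dead _ _ _) = refl

  mark-reopen : ∀ {i} (s : Status i) → mark (reopenStatus s) ≡ reopen (mark s)
  mark-reopen (eligible _) = refl
  mark-reopen (excluded _) = refl
  mark-reopen active       = refl
  mark-reopen low          = refl
  mark-reopen (passed _ _) = refl
  mark-reopen (dead _ _ _) = refl

  module _ (σ : State) (j : Fin n) (eligible-j : mark (status σ j) ≡ eligible) where

    private
      st′ : Board
      st′ i with Fin.<-cmp i j
      ... | tri< i<j _ _ = leave i<j (status σ i)
      ... | tri≈ _ _ _   = active
      ... | tri> _ _ _   = reopenStatus (status σ i)

      free-j : mark (status σ j) ≢ gone
      free-j eq = case trans (sym eligible-j) eq of λ ()

      mono : boardAssign (status σ) ⊑ boardAssign st′
      mono (R k) eq with Fin.<-cmp k j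
      ... | tri≈ _ refl _ = contradiction eq (undecidedR (status σ k) free-j)
      mono (R k) eq | tri< _ _ _ with status σ k
      ... | eligible _ = case eq of λ ()
      ... | excluded _ = case eq of λ ()
      ... | active     = eq
      ... | low        = eq
      ... | passed _ _ = eq
      ... | dead _ _ _ = eq
      mono (R k) eq | tri> _ _ _ with status σ k
      ... | eligible _ = case eq of λ ()
      ... | excluded _ = case eq of λ ()
      ... | active     = eq
      ... | low        = eq
      ... | passed _ _ = eq
      ... | dead _ _ _ = eq
      mono (P k) eq with Fin.<-cmp k j
      ... | tri≈ _ refl _ = contradiction eq (undecidedP (status σ k) free-j)
      mono (P k) eq | tri< _ _ _ with status σ k
      ... | eligible _ = case eq of λ ()
      ... | excluded _ = case eq of λ ()
      ... | active     = eq
      ... | low        = eq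
      ... | passed _ _ = eq
      ... | dead _ _ _ = eq
      mono (P k) eq | tri> _ _ _ with status σ k
      ... | eligible _ = case eq of λ ()
      ... | excluded _ = case eq of λ ()
      ... | active     = eq
      ... | low        = eq
      ... | passed _ _ = eq
      ... | dead _ _ _ = eq
      mono (S k i _) eq with Fin.<-cmp k j
      ... | tri≈ _ refl _ = contradiction eq (undecidedS (status σ k) free-j)
      mono (S k i _) eq | tri< _ _ _ with status σ k
      ... | eligible _ = case eq of λ ()
      ... | excluded _ = case eq of λ ()
      ... | low        = eq
      ... | passed _ _ = eq
      ... | dead _ _ _ = eq
      ... | active with i Fin.≟ j
      -- This edge turns true; it was undecided because `j` was eligible.
      ...   | yes refl rewrite eligible-j = case eq of λ ()
      ...   | no _ with mark (status σ i)
      ...     | excluded = eq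
      ...     | gone     = eq
      mono (S k i _) eq | tri> _ _ j<k with status σ k in act
      ... | eligible _ = case eq of λ ()
      ... | excluded _ = case eq of λ ()
      -- Only an active source could notice that targets above `j` are reopened, and `active-below`
      -- puts it below the free `j`.
      ... | active     = contradiction (active-below σ act free-j) (<-asym j<k)
      ... | low        = eq
      ... | passed _ _ = eq
      ... | dead _ _ _ = eq

      at-j : st′ j ≡ active
      at-j with Fin.<-cmp j j
      ... | tri< _ j≢j _ = contradiction refl j≢j
      ... | tri≈ _ _ _   = refl
      ... | tri> _ j≢j _ = contradiction refl j≢j

      active-is-j : ∀ k → st′ k ≡ active → k ≡ j
      active-is-j k act with Fin.<-cmp k j
      ... | tri≈ _ k≡j _ = k≡j
      active-is-j k act | tri< _ _ _ with status σ k
      ... | eligible _ = case act of λ ()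
      ... | excluded _ = case act of λ ()
      ... | active     = case act of λ ()
      ... | low        = case act of λ ()
      ... | passed _ _ = case act of λ ()
      ... | dead _ _ _ = case act of λ ()
      active-is-j k act | tri> _ _ j<k with status σ k in eq
      ... | eligible _ = case act of λ ()
      ... | excluded _ = case act of λ ()
      ... | active     = contradiction (active-below σ eq free-j) (<-asym j<k)
      ... | low        = case act of λ ()
      ... | passed _ _ = case act of λ ()
      ... | dead _ _ _ = case act of λ ()

      free-above : ∀ k → mark (st′ k) ≢ gone → j Fin.< k
      free-above k f with Fin.<-cmp k j
      ... | tri< k<j _ _ = contradiction (mark-leave k<j (status σ k)) f
      ... | tri≈ _ _ _   = contradiction refl f
      ... | tri> _ _ j<k = j<k

      chain-mono : ∀ {k} → OnChain (status σ k) → OnChain (st′ k)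
      chain-mono {k} (r , p) = mono (R k) r , mono (P k) p

      chain-j : OnChain (st′ j)
      chain-j rewrite at-j = refl , refl

      passed-onto : ∀ k {i k<i} → st′ k ≡ passed i k<i → OnChain (st′ i)
      passed-onto k pass with Fin.<-cmp k j
      ... | tri≈ _ _ _ = case pass of λ ()
      passed-onto k pass | tri< _ _ _ with status σ k in eq
      ... | eligible _ = case pass of λ ()
      ... | excluded _ = case pass of λ ()
      ... | low        = case pass of λ ()
      ... | dead _ _ _ = case pass of λ ()
      ... | active     with refl ← pass = chain-j
      ... | passed _ _ with refl ← pass = chain-mono (passed-to σ eq)
      passed-onto k pass | tri> _ _ j<k with status σ k in eq
      ... | eligible _ = case pass of λ ()
      ... | excluded _ = case pass of λ ()
      ... | active     = case pass of λ ()
      ... | low        = case pass of λ ()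
      ... | dead _ _ _ = case pass of λ ()
      ... | passed _ _ with refl ← pass = chain-mono (passed-to σ eq)

    jump : State
    jump .status = st′
    jump .active-below {a} {k} act f =
      subst (Fin._< k) (sym (active-is-j a act)) (free-above k f)
    jump .passed-to {a} = passed-onto a
    jump .first-chain = chain-mono (first-chain σ)
    jump .last-low = mono (R last) (proj₁ (last-low σ)) , mono (P last) (proj₂ (last-low σ))

    jump-mono : assign σ ⊑ assign jump
    jump-mono = mono

    jump-active : status jump j ≡ active
    jump-active = at-j

    jump-edge : ∀ {i} → status σ i ≡ active → .(i<j : i Fin.< j) → assign jump (S i j i<j) ≡ just true
    jump-edge {i} act _ with Fin.<-cmp i j
    ... | tri≈ i≮j _ _ = contradiction (active-below σ act free-j) i≮j
    ... | tri> i≮j _ _ = contradiction (active-below σ act free-j) i≮j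
    ... | tri< _ _ _ rewrite act = cong just (≟-refl j)

    value-jump : value jump ≡ weightSum (countAbove (marks σ) j)
    value-jump = potential-jump (marks σ) (marks jump) j below above
      where
      below : ∀ i → i Fin.≤ j → mark (st′ i) ≡ gone
      below i i≤j with Fin.<-cmp i j
      ... | tri< i<j _ _ = mark-leave i<j (status σ i)
      ... | tri≈ _ _ _   = refl
      ... | tri> _ _ j<i = contradiction i≤j (<⇒≱ j<i)
      above : ∀ i → j Fin.< i → mark (st′ i) ≡ reopen (mark (status σ i))
      above i j<i with Fin.<-cmp i j
      ... | tri< _ _ j≮i = contradiction j<i j≮i
      ... | tri≈ _ _ j≮i = contradiction j<i j≮i
      ... | tri> _ _ _   = mark-reopen (status σ i)

  -- Delayer's answers and their cost.

  open ProverDelayer assign value 5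

  -- Excluding an eligible `j` costs exactly `weight c`, while moving to `j` leaves `weightSum c`;
  -- by `3weight≤9+weightSum` the former exceeds the latter by at most a constant.
  respondActive : ∀ σ i j .(i<j : i Fin.< j) → status σ i ≡ active → Response σ (S i j i<j)
  respondActive σ i j i<j act with mark (status σ j) in eq
  ... | excluded = forced false σ (λ _ e → e) (cong₂ (λ s x → valueS s x j) act eq) ≤-refl
  ... | gone     = forced false σ (λ _ e → e) (cong₂ (λ s x → valueS s x j) act eq) ≤-refl
  ... | eligible = branch τ
      (λ { true → jump-mono σ j eq ; false → demote-mono σ j free-j refuted excluded })
      (λ { true → jump-edge σ j eq act i<j
         ; false → cong₂ (λ s x → valueS s x j)
             (trans (update-other (status σ) j refuted i i≢j) act)
             (demote-same σ j free-j refuted excluded) })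
      bound
    where
    free-j : mark (status σ j) ≢ gone
    free-j e = case trans (sym eq) e of λ ()
    i≢j : i ≢ j
    i≢j refl = case trans (sym eq) (cong mark act) of λ ()
    refuted : Status j
    refuted = excluded (headroom (status σ j) free-j)
    τ : Bool → State
    τ true  = jump σ j eq
    τ false = demote σ j free-j refuted excluded
    c : ℕ
    c = countAbove (marks σ) j
    bound : value σ ≤ 5 + (value (τ true) + value (τ false))
    bound = begin
      value σ                                       ≡⟨ potential-exclude (marks σ) (marks (τ false)) j eq
                                                        (demote-same σ j free-j refuted excluded)
                                                        (demote-other σ j free-j refuted excluded) ⟩
      weight c + value (τ false)                    ≤⟨ +-monoˡ-≤ (value (τ false)) weight≤ ⟩
      5 + weightSum c + value (τ false)             ≡⟨ cong (λ x → 5 + x + value (τ false)) (value-jump σ j eq) ⟨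
      5 + (value (τ true) + value (τ false))        ∎
      where
      open ≤-Reasoning
      weight≤ : weight c ≤ 5 + weightSum c
      weight≤ = *-cancelˡ-≤ 3 (begin
        3 * weight c            ≤⟨ 3weight≤9+weightSum c ⟩
        9 + weightSum c         ≤⟨ +-mono-≤ (≤ᵇ⇒≤ 9 15 _) (m≤n*m (weightSum c) 3) ⟩
        15 + 3 * weightSum c    ≡⟨ *-distribˡ-+ 3 5 (weightSum c) ⟨
        3 * (5 + weightSum c)   ∎)

  -- Up to constants: if `g` is at most a third of `v`, two thirds remain, and the factor 3/4 from
  -- `potential-retire` leaves half after either answer. The 10 is twice the constant 5 of the game,
  -- large enough for the 9 in `3weight≤9+weightSum`.
  halving : ∀ v g a b → 3 * v ≤ 3 * g + 4 * a → 3 * v ≤ 3 * g + 4 * b → 3 * g ≤ 10 + v →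
            v ≤ 5 + (a + b)
  halving v g a b va vb gv = *-cancelˡ-≤ 4 (+-cancelʳ-≤ (2 * v) _ _ (begin
    4 * v + 2 * v                                ≡⟨ six v ⟩
    3 * v + 3 * v                                ≤⟨ +-mono-≤ va vb ⟩
    3 * g + 4 * a + (3 * g + 4 * b)              ≤⟨ +-mono-≤ (+-monoˡ-≤ (4 * a) gv) (+-monoˡ-≤ (4 * b) gv) ⟩
    10 + v + 4 * a + (10 + v + 4 * b)            ≡⟨ collect v a b ⟩
    4 * (5 + (a + b)) + 2 * v                    ∎))
    where
    open ≤-Reasoning
    six : ∀ v → 4 * v + 2 * v ≡ 3 * v + 3 * v
    six = solve-∀
    collect : ∀ v a b → 10 + v + 4 * a + (10 + v + 4 * b) ≡ 4 * (5 + (a + b)) + 2 * v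
    collect = solve-∀

  -- If i carries at most about a third of the potential, retiring it at most
  -- halves the potential, so both answers may be offered. Otherwise moving the
  -- end of the chain to i loses nothing, since potential refills above i.
  respondFree : ∀ σ i x → mark (status σ i) ≢ gone →
                (profile : Bool → Status i) → (∀ b → Demoted (profile b)) →
                (∀ b → mark (profile b) ≡ gone) →
                (∀ b → boardAssign (status σ [ i ≔ profile b ]) x ≡ just b) →
                (∀ τ → status τ i ≡ active → Response τ x) →
                Response σ x
  respondFree σ i x free-i profile demoted retired answers onActive = by (mark (status σ i)) refl
    where
    τ : Bool → State
    τ b = demote σ i free-i (profile b) (demoted b)
    c : ℕ
    c = countAbove (marks σ) i
    retire : 3 * gain (marks σ i) c ≤ 10 + value σ → Response σ x
    retire small = branch τ (λ b → demote-mono σ i free-i (profile b) (demoted b)) answers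
      (halving (value σ) (gain (marks σ i) c) (value (τ true)) (value (τ false)) (loss true) (loss false) small)
      where
      loss : ∀ b → 3 * value σ ≤ 3 * gain (marks σ i) c + 4 * value (τ b)
      loss b = potential-retire (marks σ) (marks (τ b)) i free-i
        (trans (demote-same σ i free-i (profile b) (demoted b)) (retired b))
        (demote-other σ i free-i (profile b) (demoted b))
    by : ∀ y → mark (status σ i) ≡ y → Response σ x
    by gone     eq = contradiction eq free-i
    by excluded eq = retire (subst (λ y → 3 * gain y c ≤ 10 + value σ) (sym eq) z≤n)
    -- `weightSum c` is the value after moving the end to `i`. If it is below the current value,
    -- then `weight c`, about a third of it, is small enough to retire `i`.
    by eligible eq with value σ ≤? weightSum c
    ... | yes light = after (jump-mono σ i eq)
            (≤-trans light (≤-reflexive (sym (value-jump σ i eq))))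
            (onActive (jump σ i eq) (jump-active σ i eq))
    ... | no heavy  = retire (subst (λ y → 3 * gain y c ≤ 10 + value σ) (sym eq)
            (≤-trans (3weight≤9+weightSum c) (+-mono-≤ (n≤1+n 9) (<⇒≤ (≰⇒> heavy)))))

  -- Take the last vertex, or `i + 1` if `j` is the last; the bound keeps the two apart.
  avoiding : ∀ {i : Fin n} → 2 + toℕ i ≤ m → ∀ j → ∃[ k ] (i Fin.< k × not ⌊ k Fin.≟ j ⌋ ≡ true)
  avoiding {i} h j with last Fin.≟ j in eq
  ... | no _ = last , i<last (<-trans (n<1+n _) h) , cong (not ∘ ⌊_⌋) eq
  ... | yes refl = k , subst (toℕ i <_) (sym toℕ-k) (n<1+n _) , k≢last
    where
    k : Fin n
    k = Fin.fromℕ< {suc (toℕ i)} (m≤n⇒m≤1+n h)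
    toℕ-k : toℕ k ≡ suc (toℕ i)
    toℕ-k = Fin.toℕ-fromℕ< (m≤n⇒m≤1+n h)
    k≢last : not ⌊ k Fin.≟ last ⌋ ≡ true
    k≢last with k Fin.≟ last
    ... | no _ = refl
    ... | yes k≡last =
      contradiction (trans (sym toℕ-k) (trans (cong toℕ k≡last) (toℕ-fromℕ m))) (<⇒≢ h)

  respond : ∀ σ x → Response σ x
  respond σ (R i) = by (status σ i) refl
    where
    -- If R is granted, falsifying P makes the P-step clauses out of `i` hold, and the only true
    -- edge leads to the last vertex, where R holds.
    profile : 2 + toℕ i ≤ m → Bool → Status i
    profile h true  = low
    profile h false = always false (<-trans (n<1+n _) h)
    onFree : 2 + toℕ i ≤ m → mark (status σ i) ≢ gone → Response σ (R i)
    onFree h free-i = respondFree σ i (R i) free-i (profile h)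
      (λ { true → low ; false → dead }) (λ { true → refl ; false → refl })
      (λ { true → cong valueR (update-same (status σ) i low)
         ; false → cong valueR (update-same (status σ) i (profile h false)) })
      (λ τ act → forced true τ (λ _ e → e) (cong valueR act) ≤-refl)
    by : ∀ s → status σ i ≡ s → Response σ (R i)
    by (eligible h) eq = onFree h (subst (λ s → mark s ≢ gone) (sym eq) λ ())
    by (excluded h) eq = onFree h (subst (λ s → mark s ≢ gone) (sym eq) λ ())
    by active       eq = forced _ σ (λ _ e → e) (cong valueR eq) ≤-refl
    by low          eq = forced _ σ (λ _ e → e) (cong valueR eq) ≤-refl
    by (passed _ _) eq = forced _ σ (λ _ e → e) (cong valueR eq) ≤-refl
    by (dead _ _ _) eq = forced _ σ (λ _ e → e) (cong valueR eq) ≤-refl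
  respond σ (P i) = by (status σ i) refl
    where
    -- With R false the step clauses out of `i` hold, so P may take either value.
    profile : 2 + toℕ i ≤ m → Bool → Status i
    profile h p = always p (<-trans (n<1+n _) h)
    onFree : 2 + toℕ i ≤ m → mark (status σ i) ≢ gone → Response σ (P i)
    onFree h free-i = respondFree σ i (P i) free-i (profile h)
      (λ _ → dead) (λ _ → refl)
      (λ p → cong valueP (update-same (status σ) i (profile h p)))
      (λ τ act → forced true τ (λ _ e → e) (cong valueP act) ≤-refl)
    by : ∀ s → status σ i ≡ s → Response σ (P i)
    by (eligible h) eq = onFree h (subst (λ s → mark s ≢ gone) (sym eq) λ ())
    by (excluded h) eq = onFree h (subst (λ s → mark s ≢ gone) (sym eq) λ ())
    by active       eq = forced _ σ (λ _ e → e) (cong valueP eq) ≤-refl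
    by low          eq = forced _ σ (λ _ e → e) (cong valueP eq) ≤-refl
    by (passed _ _) eq = forced _ σ (λ _ e → e) (cong valueP eq) ≤-refl
    by (dead _ _ _) eq = forced _ σ (λ _ e → e) (cong valueP eq) ≤-refl
  respond σ (S i j i<j) = by (status σ i) refl
    where
    valueS-by : ∀ {s} → status σ i ≡ s → assign σ (S i j i<j) ≡ valueS s (mark (status σ j)) j
    valueS-by eq = cong (λ s → valueS s (mark (status σ j)) j) eq
    profile : 2 + toℕ i ≤ m → Bool → Status i
    profile h true  = always false (<-trans (n<1+n _) h)
    -- All edges but the refuted one are true, and `avoiding` supplies one of them.
    profile h false = dead false (λ k → not ⌊ k Fin.≟ j ⌋) (avoiding h j)
    update-answers : ∀ h b → boardAssign (status σ [ i ≔ profile h b ]) (S i j i<j) ≡ just b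
    update-answers h true = cong (λ s → valueS s (mark ((status σ [ i ≔ profile h true ]) j)) j)
      (update-same (status σ) i (profile h true))
    update-answers h false = trans
      (cong (λ s → valueS s (mark ((status σ [ i ≔ profile h false ]) j)) j)
            (update-same (status σ) i (profile h false)))
      (cong (just ∘ not) (≟-refl j))
    onFree : 2 + toℕ i ≤ m → mark (status σ i) ≢ gone → Response σ (S i j i<j)
    onFree h free-i = respondFree σ i (S i j i<j) free-i (profile h)
      (λ { true → dead ; false → dead }) (λ { true → refl ; false → refl })
      (update-answers h)
      (λ τ → respondActive τ i j i<j)
    by : ∀ s → status σ i ≡ s → Response σ (S i j i<j)
    by (eligible h) eq = onFree h (subst (λ s → mark s ≢ gone) (sym eq) λ ())
    by (excluded h) eq = onFree h (subst (λ s → mark s ≢ gone) (sym eq) λ ())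
    by active       eq = respondActive σ i j i<j eq
    by low          eq = forced _ σ (λ _ e → e) (valueS-by eq) ≤-refl
    by (passed _ _) eq = forced _ σ (λ _ e → e) (valueS-by eq) ≤-refl
    by (dead _ _ _) eq = forced _ σ (λ _ e → e) (valueS-by eq) ≤-refl

  -- Which axioms a state can falsify.

  ≡last : ∀ {i : Fin n} → suc (toℕ i) ≡ n → i ≡ last
  ≡last eq = toℕ-injective (trans (suc-injective eq) (sym (toℕ-fromℕ m)))

  -- By the status of the source: the end has no true edge, a low vertex points to the last and
  -- falsifies P, a passed one points along the chain, and a dead one falsifies R. So no step clause
  -- is ever falsified.
  edge-end : ∀ σ i j .(i<j : i Fin.< j) → assign σ (S i j i<j) ≡ just true → assign σ (R i) ≡ just true →
             assign σ (R j) ≡ just true × (assign σ (P i) ≡ just true → assign σ (P j) ≡ just true)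
  edge-end σ i j _ s r with status σ i in eq
  ... | active with mark (status σ j)
  ...   | eligible = case s of λ ()
  ...   | excluded = case s of λ ()
  ...   | gone     = case s of λ ()
  edge-end σ i j _ s r | low with refl ← ≟-true⇒≡ {i = j} {last} (just-injective s) =
    proj₁ (last-low σ) , λ ()
  edge-end σ i j _ s r | passed k _ with refl ← ≟-true⇒≡ {i = j} {k} (just-injective s) =
    proj₁ (passed-to σ eq) , λ _ → proj₂ (passed-to σ eq)
  edge-end σ i j _ s () | dead _ _ _

  ∈-someSuccessor : ∀ {i j : Fin n} (i<j : i Fin.< j) → pos (S i j i<j) ∈ someSuccessor i
  ∈-someSuccessor {i} {j} i<j = mapMaybe⁺ edge (allFin n) (lose (∈-map⁺ edge (∈-allFin j)) holds)
    where
    edge : Fin n → Maybe (Literal (Var n))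
    edge j = Maybe.map (λ i<j → pos (S i j i<j)) (dec⇒maybe (i Fin.<? j))
    holds : Any (pos (S i j i<j) ≡_) (edge j)
    holds with i Fin.<? j
    -- The order proof inside `S` is irrelevant, so the one found by the decision serves.
    ... | yes _  = just refl
    ... | no i≮j = contradiction i<j i≮j

  -- Every status but `active` leaves some edge true or undecided. For an active source, an eligible
  -- vertex would lie above it and keep its edge undecided, so none is left.
  no-edge : ∀ σ i → toℕ i < m → (∀ j (i<j : i Fin.< j) → assign σ (S i j i<j) ≡ just false) →
            value σ ≡ 0
  no-edge σ i i<m none with status σ i in eq
  ... | eligible _ = case none last (i<last i<m) of λ ()
  ... | excluded _ = case none last (i<last i<m) of λ ()
  ... | low        = case trans (sym (cong just (≟-refl last))) (none last (i<last i<m)) of λ ()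
  ... | passed k p = case trans (sym (cong just (≟-refl k))) (none k p) of λ ()
  ... | dead _ s (k , i<k , sk) = case trans (sym (cong just sk)) (none k i<k) of λ ()
  ... | active     = potential-none (marks σ) ineligible
    where
    ineligible : ∀ j → marks σ j ≢ eligible
    ineligible j e = case trans (sym (cong (λ x → valueS {i} active x j) e))
        (none j (active-below σ eq λ g → case trans (sym e) g of λ ())) of λ ()

  lost : ∀ {A} σ → RIP n A → Falsifies (assign σ) A → value σ ≡ 0
  lost σ (P-first {zero} _) fals = case trans (sym (proj₂ (first-chain σ))) (fals (here refl)) of λ ()
  lost σ (R-first {zero} _) fals = case trans (sym (proj₁ (first-chain σ))) (fals (here refl)) of λ ()
  lost σ (P-last eq) fals with refl ← ≡last eq =
    case trans (sym (proj₂ (last-low σ))) (fals (here refl)) of λ ()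
  lost σ (R-last eq) fals with refl ← ≡last eq =
    case trans (sym (proj₁ (last-low σ))) (fals (here refl)) of λ ()
  lost σ (S-some {i} (s≤s i<m)) fals = no-edge σ i i<m (λ j i<j → fals (∈-someSuccessor i<j))
  lost σ (R-step {i} {j} i<j) fals =
    case trans (sym (proj₁ (edge-end σ i j i<j (fals (here refl)) (fals (there (here refl))))))
               (fals (there (there (here refl)))) of λ ()
  lost σ (P-step {i} {j} i<j) fals =
    case trans (sym (proj₂ (edge-end σ i j i<j (fals (here refl)) (fals (there (here refl))))
                           (fals (there (there (here refl))))))
               (fals (there (there (there (here refl))))) of λ ()

  -- The initial state and the final estimate.

  initialStatus : Board
  initialStatus zero = active
  initialStatus (suc i) with 3 + toℕ i ≤? m
  ... | yes h = eligible h
  ... | no _ with suc i Fin.≟ last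
  ...   | yes _ = low
  -- Only the vertex just before the last gets here: with a single successor it cannot be free.
  ...   | no i≢last = always false (≤∧≢⇒< (Fin.toℕ≤pred[n] (suc i))
                        λ eq → i≢last (≡last (cong suc eq)))

  initial : State
  initial .status = initialStatus
  initial .active-below {i} {k} act f = subst (Fin._< k) (sym (is-first i act)) (above k f)
    where
    is-first : ∀ i → initialStatus i ≡ active → i ≡ zero
    is-first zero _ = refl
    is-first (suc i) act with 3 + toℕ i ≤? m
    ... | yes _ = case act of λ ()
    ... | no _ with suc i Fin.≟ last
    ...   | yes _ = case act of λ ()
    ...   | no _  = case act of λ ()
    above : ∀ k → mark (initialStatus k) ≢ gone → zero {n = m} Fin.< k
    above zero    f = contradiction refl f
    above (suc k) f = s≤s z≤n
  initial .passed-to {i} = never i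
    where
    never : ∀ i {k i<k} → initialStatus i ≡ passed k i<k → OnChain (initialStatus k)
    never (suc i) eq with 3 + toℕ i ≤? m
    ... | yes _ = case eq of λ ()
    ... | no _ with suc i Fin.≟ last
    ...   | yes _ = case eq of λ ()
    ...   | no _  = case eq of λ ()
  initial .first-chain = refl , refl
  initial .last-low with 3 + toℕ (fromℕ l) ≤? m
  ... | yes h = contradiction (subst (λ x → 3 + x ≤ m) (toℕ-fromℕ l) h) (<⇒≱ (s≤s (n≤1+n m)))
  ... | no _ with suc (fromℕ l) Fin.≟ last
  ...   | yes _ = refl , refl
  ...   | no ≢last = contradiction refl ≢last

  -- All vertices start eligible except the first and the last two, and nothing is excluded yet, so
  -- `potential-all` evaluates the sum.
  value-initial : weightSum (l ∸ 1) ≤ value initial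
  value-initial = ≤-trans (weightSum-mono many) (≤-reflexive (sym (potential-all (marks initial) all)))
    where
    all : ∀ i → marks initial i ≢ excluded
    all zero ()
    all (suc i) with 3 + toℕ i ≤? m
    ... | yes _ = λ ()
    ... | no _ with suc i Fin.≟ last
    ...   | yes _ = λ ()
    ...   | no _  = λ ()
    many : l ∸ 1 ≤ count (marks initial)
    many = count-≥ (marks initial ∘ suc) (l ∸ 1) (≤-trans (m∸n≤m l 1) (n≤1+n l)) free-suc
      where
      free-suc : ∀ i → toℕ i < l ∸ 1 → marks initial (suc i) ≢ gone
      free-suc i i< with 3 + toℕ i ≤? m
      ... | yes _ = λ ()
      ... | no ¬h = contradiction (s≤s (pred-cancel-< {suc (toℕ i)} i<)) ¬h

  weightSum≤5size : (π : TreeRefutation (RIP n)) → weightSum (l ∸ 1) ≤ 5 * size π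
  weightSum≤5size π = ≤-trans value-initial (value≤size respond lost π initial λ ())

-- By `weight-3*` and the telescoped bound, `9 * x` is at most `9 + 5 * size π`. The `2 +` in the
-- exponent makes `x` at least 4, so that `4 * x` absorbs the 9.
2^q≤size : ∀ q l → (2 + q) * 3 ≤ l ∸ 1 → (π : TreeRefutation (RIP (2 + l))) → 2 ^ (2 + q) ≤ size π
2^q≤size q l q≤l π = *-cancelˡ-≤ 5 (+-cancelˡ-≤ 9 _ _ (begin
  9 + 5 * x                                ≤⟨ +-monoˡ-≤ (5 * x) 9≤4x ⟩
  4 * x + 5 * x                            ≡⟨ nine x ⟩
  3 * (3 * x)                              ≡⟨ cong (3 *_) (weight-3* (2 + q)) ⟨
  3 * weight ((2 + q) * 3)                 ≤⟨ 3weight≤9+weightSum ((2 + q) * 3) ⟩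
  9 + weightSum ((2 + q) * 3)              ≤⟨ +-monoʳ-≤ 9 (weightSum-mono q≤l) ⟩
  9 + weightSum (l ∸ 1)                    ≤⟨ +-monoʳ-≤ 9 (Game.weightSum≤5size l π) ⟩
  9 + 5 * size π                           ∎))
  where
  open ≤-Reasoning
  x : ℕ
  x = 2 ^ (2 + q)
  9≤4x : 9 ≤ 4 * x
  9≤4x = ≤-trans (≤ᵇ⇒≤ 9 16 _) (*-monoʳ-≤ 4 (*-monoʳ-≤ 2 (*-monoʳ-≤ 2 (m^n>0 2 q))))
  nine : ∀ x → 4 * x + 5 * x ≡ 3 * (3 * x)
  nine = solve-∀

proposition5 : ∃[ c ] (Positive c × (∃[ n₀ ] (∀ (n : ℕ) → 2 ≤ n → n₀ ≤ n →
    (π : TreeRefutation (RIP n)) → size π ≥2^ c · n)))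
-- For `n = 9 + k` the game starts with `6 + k` eligible vertices, so `q = k / 3` yields
-- `2 ^ (2 + q)`. The exponent is about n/3; the rate 1/6 covers the rounding, and 9 is the least
-- `n` with two full blocks of three eligible vertices.
proposition5 = ℤ.+ 1 / 6 , _ , 9 , λ n _ 9≤n →
  subst (λ n → (π : TreeRefutation (RIP n)) → size π ≥2^ ℤ.+ 1 / 6 · n) (m+[n∸m]≡n 9≤n) (bound (n ∸ 9))
  where
  bound : ∀ k → (π : TreeRefutation (RIP (9 + k))) → 2 ^ (1 * (9 + k)) ≤ size π ^ 6
  bound k π = begin
    2 ^ (1 * (9 + k))     ≡⟨ cong (2 ^_) (*-identityˡ (9 + k)) ⟩
    2 ^ (9 + k)           ≤⟨ ^-monoʳ-≤ 2 9+k≤ ⟩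
    2 ^ ((2 + q) * 6)     ≡⟨ ^-*-assoc 2 (2 + q) 6 ⟨
    (2 ^ (2 + q)) ^ 6     ≤⟨ ^-monoˡ-≤ 6 (2^q≤size q (7 + k) (+-monoʳ-≤ 6 (m/n*n≤m k 3)) π) ⟩
    size π ^ 6            ∎
    where
    open ≤-Reasoning
    q : ℕ
    q = k ℕ./ 3
    9+k≤ : 9 + k ≤ (2 + q) * 6
    9+k≤ = begin
      9 + k                      ≡⟨ cong (9 +_) (m≡m%n+[m/n]*n k 3) ⟩
      9 + (k ℕ.% 3 + q * 3)      ≤⟨ +-monoʳ-≤ 9 (+-mono-≤ (<⇒≤ (m%n<n k 3)) (*-monoʳ-≤ q (≤ᵇ⇒≤ 3 6 _))) ⟩
      9 + (3 + q * 6)            ≡⟨⟩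
      (2 + q) * 6                ∎
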